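{- Let $p$ be a prime and let $L=\{l_1,l_2,\ldots,l_s\}$ and $K=\{k_1,k_2,\ldots,k_r\}$ be two disjoint subsets of $\{0,1,\ldots,p-1\}$ (with $|L|=s$, $|K|=r$). Suppose that $\mathcal{A}=\{A_1,\ldots,A_m\}$ is a family of subsets of $[n]=\{1,2,\ldots,n\}$ such that $|A_i|\pmod{p}\in K$ for all $A_i\in \mathcal{A}$ and $|A_i\cap A_j|\pmod{p}\in L$ for every $i\neq j$. If $n\geq 2s-2r+1$, then \[ |\mathcal{A}|\leq {n-1 \choose s}+{n-1 \choose s-1}+\cdots+{n-1 \choose s-2r+1}. \]
   Context: Binomial coefficients ${a\choose b}$ with $b<0$ are interpreted as $0$. -}

module Defs where

open import Data.Nat using (ℕ; zero; suc; _+_; _*_; _∸_)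
open import Data.Nat.Combinatorics using (_C_)
open import Data.Nat.DivMod using (_mod_)
open import Data.Nat.Primality using (Prime; prime⇒nonZero)
open import Data.Integer as ℤ using (ℤ; +_; -[1+_])
open import Data.Fin using (Fin)
open import Data.List using (map; upTo)
open import Data.Nat.ListAction using (sum)

binomℤ : ℕ → ℤ → ℕ
binomℤ a (+ b)    = a C b
binomℤ a -[1+ _ ] = 0

modP : (p : ℕ) → Prime p → ℕ → Fin p
modP p pr x = _mod_ x p {{prime⇒nonZero pr}}

boundSum : (n s r : ℕ) → ℕ
boundSum n s r = sum (map (λ t → binomℤ (n ∸ 1) ((+ s) ℤ.- (+ t))) (upTo (2 * r)))

{-# OPTIONS --safe #-}
module Submission where

-- Replacing x₁ by 1 turns the polynomials ∏_{l∈L}(|A_i ∩ x| − l) into functions F_i of degree at most s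
-- on the cube {0,1}^N, N = n − 1. Put γ(x) = ∏_{k∈K}(|x| − k)(|x| − k + 1), which vanishes mod p at every
-- A_j with its first point removed. Evaluating there, first for the A_j containing that point and then for
-- the others, shows that a relation Σ b_i F_i + γ h ≡ 0 forces b ≡ 0, and hence γ h ≡ 0. If deg h ≤ s − 2r
-- this forces h ≡ 0, so m plus the dimension of degree ≤ s − 2r is at most the dimension of degree ≤ s.
--
-- That γ can be cancelled is proved by induction on deg h: the differences h(…10…) − h(…01…) have smaller
-- degree and are killed by a shift of γ, so they vanish, and h is a function φ(|x|) with Δ^{deg h + 1} φ ≡ 0;
-- a linear factor (w − c) φ(w) ≡ 0 is removed by the Leibniz rule for Δ. All functions are integer valued
-- with exact identities; only vanishing is read modulo p, so no division in the field is needed.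

open import Defs
open import Data.Nat using (ℕ; _+_; _*_; _≤_)
open import Data.Nat.Primality using (Prime)
open import Data.Fin using (Fin)
open import Data.Fin.Subset using (Subset; _∈_; _∉_; _∩_; ∣_∣)
open import Function.Definitions using (Injective)
open import Relation.Binary.PropositionalEquality using (_≡_)
open import Relation.Nullary using (¬_)

open import Data.Empty using (⊥-elim)
open import Data.Unit using (⊤; tt)
open import Data.Nat using (zero; suc; _∸_; _<_; z≤n; s≤s; s≤s⁻¹; nonTrivial⇒n>1)
open import Data.Nat.Combinatorics using (_C_; nCk+nC[k+1]≡[n+1]C[k+1])
open import Data.Nat.DivMod using (_%_; _/_; m≡m%n+[m/n]*n; m%n<n)
open import Data.Nat.Divisibility using (∣⇒≤) renaming (_∣_ to _∣ℕ_)
open import Data.Nat.ListAction using (sum)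
open import Data.Nat.Primality using (euclidsLemma; prime⇒nonZero; prime⇒nonTrivial)
import Data.Nat.Properties as ℕ
import Data.Nat.Tactic.RingSolver as ℕ-Ring
open import Data.Integer as ℤ using (ℤ; +_; 0ℤ; 1ℤ)
import Data.Integer.Properties as ℤ
open import Data.Integer.Divisibility.Signed using (divides; _∣?_; ∣⇒∣ᵤ; ∣ᵤ⇒∣; ∣m∣n⇒∣m+n; ∣m∣n⇒∣m-n; ∣m⇒∣-m; ∣m+n∣m⇒∣n; ∣m+n∣n⇒∣m; ∣n⇒∣m*n; ∣m⇒∣m*n) renaming (_∣_ to _∣ℤ_)
open import Data.Integer.Tactic.RingSolver using (solve-∀)
open import Data.Fin using (zero; suc; toℕ; _↑ˡ_; _↑ʳ_; splitAt)
import Data.Fin.Properties as Fin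
open import Data.Fin.Subset using (inside; outside)
open import Data.Fin.Subset.Properties using (∣p∣≤n; ∣p∣≡n⇒p≡⊤; ∈⊤; ∩-idem)
open import Data.List as List using (List; []; _∷_; _++_; length; applyUpTo)
import Data.List.Properties as List
open import Data.List.Relation.Unary.All as All using (All; []; _∷_)
import Data.List.Relation.Unary.All.Properties as All
open import Data.List.Relation.Unary.Any using (Any; here; there)
import Data.List.Relation.Unary.Any.Properties as Any
open import Data.Product using (∃; _×_; _,_)
open import Data.Sum as Sum using (_⊎_; inj₁; inj₂)
open import Data.Vec.Functional using () renaming (_∷_ to _◂_)
open import Data.Vec using ([]; _∷_; here; there; head; tail)
open import Function using (_∘_)
open import Relation.Binary.PropositionalEquality using (refl; sym; trans; cong; cong₂; subst; module ≡-Reasoning)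
open import Relation.Nullary using (yes; no)

-- Functions on the discrete cube

-- The multilinear degree is strictly below d, so d = 0 leaves only the zero function.
Deg : ∀ N → ℕ → (Subset N → ℤ) → Set
Deg N       zero    f = ∀ x → f x ≡ 0ℤ
Deg zero    (suc d) f = ⊤
Deg (suc N) (suc d) f =
  Deg N (suc d) (λ x → f (outside ∷ x)) ×
  Deg N d (λ x → f (inside ∷ x) ℤ.- f (outside ∷ x))

Deg-cong : ∀ N d {f g} → (∀ x → f x ≡ g x) → Deg N d f → Deg N d g
Deg-cong N       zero    f≗g f0        = λ x → trans (sym (f≗g x)) (f0 x)
Deg-cong zero    (suc d) f≗g _         = tt
Deg-cong (suc N) (suc d) f≗g (df , dΔ) =
  Deg-cong N (suc d) (λ x → f≗g _) df ,
  Deg-cong N d (λ x → cong₂ ℤ._-_ (f≗g _) (f≗g _)) dΔ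

Deg-0 : ∀ N d → Deg N d (λ _ → 0ℤ)
Deg-0 N       zero    = λ _ → refl
Deg-0 zero    (suc d) = tt
Deg-0 (suc N) (suc d) = Deg-0 N (suc d) , Deg-0 N d

Deg-+ : ∀ N d {f g} → Deg N d f → Deg N d g → Deg N d (λ x → f x ℤ.+ g x)
Deg-+ N       zero    f0 g0 = λ x → cong₂ ℤ._+_ (f0 x) (g0 x)
Deg-+ zero    (suc d) _  _  = tt
Deg-+ (suc N) (suc d) {f} {g} (df , dΔf) (dg , dΔg) =
  Deg-+ N (suc d) df dg ,
  Deg-cong N d (λ x → lemma (f (inside ∷ x)) (f (outside ∷ x)) (g (inside ∷ x)) (g (outside ∷ x)))
    (Deg-+ N d dΔf dΔg)
  where
  lemma : ∀ a b c e → (a ℤ.- b) ℤ.+ (c ℤ.- e) ≡ (a ℤ.+ c) ℤ.- (b ℤ.+ e)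
  lemma = solve-∀

Deg-scale : ∀ N d c {f} → Deg N d f → Deg N d (λ x → c ℤ.* f x)
Deg-scale N       zero    c f0 = λ x → trans (cong (c ℤ.*_) (f0 x)) (ℤ.*-zeroʳ c)
Deg-scale zero    (suc d) c _  = tt
Deg-scale (suc N) (suc d) c {f} (df , dΔ) =
  Deg-scale N (suc d) c df ,
  Deg-cong N d (λ x → lemma c (f (inside ∷ x)) (f (outside ∷ x))) (Deg-scale N d c dΔ)
  where
  lemma : ∀ c a b → c ℤ.* (a ℤ.- b) ≡ c ℤ.* a ℤ.- c ℤ.* b
  lemma = solve-∀

Deg-− : ∀ N d {f g} → Deg N d f → Deg N d g → Deg N d (λ x → f x ℤ.- g x)
Deg-− N d {f} {g} df dg =
  Deg-cong N d (λ x → lemma (f x) (g x)) (Deg-+ N d df (Deg-scale N d (ℤ.- 1ℤ) dg))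
  where
  lemma : ∀ a b → a ℤ.+ (ℤ.- 1ℤ) ℤ.* b ≡ a ℤ.- b
  lemma = solve-∀

Deg-suc : ∀ N d {f} → Deg N d f → Deg N (suc d) f
Deg-suc N       zero    f0        = Deg-cong N 1 (λ x → sym (f0 x)) (Deg-0 N 1)
Deg-suc zero    (suc d) _         = tt
Deg-suc (suc N) (suc d) (df , dΔ) = Deg-suc N (suc d) df , Deg-suc N d dΔ

Deg-outside : ∀ N d {f : Subset (suc N) → ℤ} → Deg (suc N) d f → Deg N d (λ x → f (outside ∷ x))
Deg-outside N zero    f0       = λ x → f0 _
Deg-outside N (suc d) (df , _) = df

Deg-inside : ∀ N d {f : Subset (suc N) → ℤ} → Deg (suc N) d f → Deg N d (λ x → f (inside ∷ x))
Deg-inside N zero    f0        = λ x → f0 _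
Deg-inside N (suc d) {f} (df , dΔ) =
  Deg-cong N (suc d) (λ x → lemma (f (inside ∷ x)) (f (outside ∷ x)))
    (Deg-+ N (suc d) df (Deg-suc N d dΔ))
  where
  lemma : ∀ a b → b ℤ.+ (a ℤ.- b) ≡ a
  lemma = solve-∀

-- Equivalent to `Deg N 2`, but with each slope `c` exposed as an integer, so that the product rule
-- can scale by it.
Affine : ∀ N → (Subset N → ℤ) → Set
Affine zero    f = ⊤
Affine (suc N) f =
  Affine N (λ x → f (outside ∷ x)) ×
  ∃ λ c → ∀ x → f (inside ∷ x) ≡ c ℤ.+ f (outside ∷ x)

Affine-− : ∀ N {f} c → Affine N f → Affine N (λ x → f x ℤ.- c)
Affine-− zero    c _ = tt
Affine-− (suc N) {f} c (af , e , f₁) =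
  Affine-− N c af , e , λ x → trans (cong (ℤ._- c) (f₁ x)) (ℤ.+-assoc e (f (outside ∷ x)) (ℤ.- c))

Affine-size : ∀ N → Affine N (λ x → + ∣ x ∣)
Affine-size zero    = tt
Affine-size (suc N) = Affine-size N , 1ℤ , λ x → refl

Affine-∩ : ∀ {N} (A : Subset N) → Affine N (λ x → + ∣ A ∩ x ∣)
Affine-∩ []            = tt
Affine-∩ (outside ∷ A) = Affine-∩ A , 0ℤ , λ x → refl
Affine-∩ (inside  ∷ A) = Affine-∩ A , 1ℤ , λ x → refl

-- By a₁f₁ - a₀f₀ = a₀(f₁ - f₀) + c f₁: induction covers the first term, and the second is a scalar
-- multiple of a slice.
Deg-*-affine : ∀ N d {a f} → Affine N a → Deg N d f → Deg N (suc d) (λ x → a x ℤ.* f x)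
Deg-*-affine N zero {a} aa f0 =
  Deg-cong N 1 (λ x → sym (trans (cong (a x ℤ.*_) (f0 x)) (ℤ.*-zeroʳ (a x)))) (Deg-0 N 1)
Deg-*-affine zero    (suc d) aa df = tt
Deg-*-affine (suc N) (suc d) {a} {f} (aa , c , a₁) (df , dΔ) =
  Deg-*-affine N (suc d) aa df ,
  Deg-cong N (suc d) eq
    (Deg-+ N (suc d) (Deg-*-affine N d aa dΔ) (Deg-scale N (suc d) c (Deg-inside N (suc d) {f} (df , dΔ))))
  where
  lemma : ∀ a c f₁ f₀ → a ℤ.* (f₁ ℤ.- f₀) ℤ.+ c ℤ.* f₁ ≡ (c ℤ.+ a) ℤ.* f₁ ℤ.- a ℤ.* f₀
  lemma = solve-∀
  eq : ∀ x → _
  eq x = trans (lemma (a (outside ∷ x)) c (f (inside ∷ x)) (f (outside ∷ x)))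
    (cong (λ t → t ℤ.* f (inside ∷ x) ℤ.- a (outside ∷ x) ℤ.* f (outside ∷ x)) (sym (a₁ x)))

prodLin : List ℤ → ℤ → ℤ
prodLin []       v = 1ℤ
prodLin (η ∷ ηs) v = (v ℤ.- η) ℤ.* prodLin ηs v

Deg-prodLin-* : ∀ N d ηs {a f} → Affine N a → Deg N d f →
  Deg N (length ηs + d) (λ x → prodLin ηs (a x) ℤ.* f x)
Deg-prodLin-* N d []       {f = f} aa df = Deg-cong N d (λ x → sym (ℤ.*-identityˡ (f x))) df
Deg-prodLin-* N d (η ∷ ηs) {a} {f} aa df =
  Deg-cong N (suc (length ηs + d)) (λ x → sym (ℤ.*-assoc (a x ℤ.- η) (prodLin ηs (a x)) (f x)))
    (Deg-*-affine N (length ηs + d) (Affine-− N η aa) (Deg-prodLin-* N d ηs aa df))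

Deg-1 : ∀ N → Deg N 1 (λ _ → 1ℤ)
Deg-1 zero    = tt
Deg-1 (suc N) = Deg-1 N , λ _ → refl

Deg-prodLin : ∀ N ηs {a} → Affine N a → Deg N (suc (length ηs)) (λ x → prodLin ηs (a x))
Deg-prodLin N ηs {a} aa = subst (λ d → Deg N d (λ x → prodLin ηs (a x))) (ℕ.+-comm (length ηs) 1)
  (Deg-cong N (length ηs + 1) (λ x → ℤ.*-identityʳ (prodLin ηs (a x)))
    (Deg-prodLin-* N 1 ηs aa (Deg-1 N)))

-- Dimension count and the binomial sum

dim : ℕ → ℕ → ℕ
dim N       zero    = 0
dim zero    (suc d) = 1
dim (suc N) (suc d) = dim N (suc d) + dim N d

-- The subsets with fewer than `d` elements; values there determine a function of degree below `d`.
lowPoints : ∀ N → ℕ → List (Subset N)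
lowPoints N       zero    = []
lowPoints zero    (suc d) = [] ∷ []
lowPoints (suc N) (suc d) =
  List.map (outside ∷_) (lowPoints N (suc d)) ++ List.map (inside ∷_) (lowPoints N d)

length-lowPoints : ∀ N d → length (lowPoints N d) ≡ dim N d
length-lowPoints N       zero    = refl
length-lowPoints zero    (suc d) = refl
length-lowPoints (suc N) (suc d) =
  trans (List.length-++ (List.map (outside ∷_) (lowPoints N (suc d)))) (cong₂ _+_
    (trans (List.length-map (outside ∷_) (lowPoints N (suc d))) (length-lowPoints N (suc d)))
    (trans (List.length-map (inside ∷_) (lowPoints N d)) (length-lowPoints N d)))

-- The multilinear polynomial with a coefficient for each set S of fewer than `d` elements; its
-- value at `x` sums those with S ⊆ `x`. Coefficients of monomials without the first variable come
-- first.
poly : ∀ N d → (Fin (dim N d) → ℤ) → Subset N → ℤ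
poly N       zero    a x             = 0ℤ
poly zero    (suc d) a []            = a zero
poly (suc N) (suc d) a (outside ∷ x) = poly N (suc d) (a ∘ (_↑ˡ dim N d)) x
poly (suc N) (suc d) a (inside ∷ x)  =
  poly N d (a ∘ (dim N (suc d) ↑ʳ_)) x ℤ.+ poly N (suc d) (a ∘ (_↑ˡ dim N d)) x

Deg-poly : ∀ N d a → Deg N d (poly N d a)
Deg-poly N       zero    a = λ x → refl
Deg-poly zero    (suc d) a = tt
Deg-poly (suc N) (suc d) a =
  Deg-poly N (suc d) _ ,
  Deg-cong N d (λ x → lemma (poly N d (a ∘ (dim N (suc d) ↑ʳ_)) x) (poly N (suc d) (a ∘ (_↑ˡ dim N d)) x))
    (Deg-poly N d (a ∘ (dim N (suc d) ↑ʳ_)))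
  where
  lemma : ∀ u v → u ≡ (u ℤ.+ v) ℤ.- v
  lemma = solve-∀

dim-suc : ∀ N d → dim N (suc d) ≡ N C d + dim N d
dim-suc zero    zero    = refl
dim-suc zero    (suc d) = refl
dim-suc (suc N) zero    = trans (ℕ.+-identityʳ (dim N 1)) (dim-suc N 0)
dim-suc (suc N) (suc d) = begin
  dim N (suc (suc d)) + dim N (suc d)                           ≡⟨ cong₂ _+_ (dim-suc N (suc d)) (dim-suc N d) ⟩
  (N C suc d + dim N (suc d)) + (N C d + dim N d)               ≡⟨ shuffle (N C suc d) (dim N (suc d)) (N C d) (dim N d) ⟩
  (N C d + N C suc d) + (dim N (suc d) + dim N d)               ≡⟨ cong (_+ (dim N (suc d) + dim N d)) (nCk+nC[k+1]≡[n+1]C[k+1] N d) ⟩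
  suc N C suc d + (dim N (suc d) + dim N d)                     ∎
  where
  open ≡-Reasoning
  shuffle : ∀ a b c d → (a + b) + (c + d) ≡ (c + a) + (b + d)
  shuffle = ℕ-Ring.solve-∀

-- Telescopes `dim-suc`. Once `R` exceeds `s + 1`, further terms have negative lower index and
-- vanish while `suc s ∸ R` stays 0, so truncated subtraction agrees with the convention for
-- binomials.
binomℤ-sum : ∀ N s R →
  sum (applyUpTo (λ t → binomℤ N ((+ s) ℤ.- (+ t))) R) + dim N (suc s ∸ R) ≡ dim N (suc s)
binomℤ-sum N s       zero    = refl
binomℤ-sum N zero    (suc R) = trans
  (cong₂ _+_ (trans (cong (_+_ (N C 0)) (negative R (λ t → t))) (ℕ.+-identityʳ (N C 0))) (cong (dim N) (ℕ.0∸n≡0 R)))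
  (sym (dim-suc N 0))
  where
  negative : ∀ R (f : ℕ → ℕ) → sum (applyUpTo (λ t → binomℤ N (0ℤ ℤ.- (+ suc (f t)))) R) ≡ 0
  negative zero    f = refl
  negative (suc R) f = negative R (f ∘ suc)
binomℤ-sum N (suc s) (suc R) = begin
  N C (suc s + 0) + sum (applyUpTo (λ t → binomℤ N ((+ suc s) ℤ.- (+ suc t))) R) + dim N (suc s ∸ R)
    ≡⟨ cong (_+ dim N (suc s ∸ R)) (cong₂ _+_ (cong (N C_) (ℕ.+-identityʳ (suc s))) (cong sum (applyUpTo-cong R shift))) ⟩
  N C suc s + sum (applyUpTo (λ t → binomℤ N ((+ s) ℤ.- (+ t))) R) + dim N (suc s ∸ R)
    ≡⟨ ℕ.+-assoc (N C suc s) _ _ ⟩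
  N C suc s + (sum (applyUpTo (λ t → binomℤ N ((+ s) ℤ.- (+ t))) R) + dim N (suc s ∸ R))
    ≡⟨ cong (_+_ (N C suc s)) (binomℤ-sum N s R) ⟩
  N C suc s + dim N (suc s)
    ≡⟨ dim-suc N (suc s) ⟨
  dim N (suc (suc s)) ∎
  where
  open ≡-Reasoning
  applyUpTo-cong : ∀ R {f g : ℕ → ℕ} → (∀ t → f t ≡ g t) → applyUpTo f R ≡ applyUpTo g R
  applyUpTo-cong zero    e = refl
  applyUpTo-cong (suc R) e = cong₂ _∷_ (e 0) (applyUpTo-cong R (e ∘ suc))
  shift : ∀ t → binomℤ N ((+ suc s) ℤ.- (+ suc t)) ≡ binomℤ N ((+ s) ℤ.- (+ t))
  shift t = cong (binomℤ N) (trans (ℤ.[1+m]⊖[1+n]≡m⊖n s t) (sym (ℤ.m-n≡m⊖n s t)))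

boundSum-dim : ∀ N s r → boundSum (suc N) s r + dim N (suc s ∸ 2 * r) ≡ dim N (suc s)
boundSum-dim N s r = trans
  (cong (λ l → sum l + dim N (suc s ∸ 2 * r)) (List.map-applyUpTo (λ t → t) (λ t → binomℤ N ((+ s) ℤ.- (+ t))) (2 * r)))
  (binomℤ-sum N s (2 * r))

-- Finite differences

Δ : (ℕ → ℤ) → ℕ → ℤ
Δ φ w = φ (suc w) ℤ.- φ w

Δ^ : ℕ → (ℕ → ℤ) → ℕ → ℤ
Δ^ zero    φ = φ
Δ^ (suc d) φ = Δ (Δ^ d φ)

Δ^-Δ : ∀ d φ w → Δ^ d (Δ φ) w ≡ Δ^ (suc d) φ w
Δ^-Δ zero    φ w = refl
Δ^-Δ (suc d) φ w = cong₂ ℤ._-_ (Δ^-Δ d φ (suc w)) (Δ^-Δ d φ w)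

-- Leibniz rule: second and higher differences of a linear factor vanish, so two terms remain, the
-- factor being taken at `w + suc d` in the first.
Δ^-linear-* : ∀ d φ c w → Δ^ (suc d) (λ w → (+ w ℤ.- c) ℤ.* φ w) w ≡
  (+ w ℤ.- c ℤ.+ + suc d) ℤ.* Δ^ (suc d) φ w ℤ.+ + suc d ℤ.* Δ^ d φ w
Δ^-linear-* zero φ c w = lemma (+ w) c (φ (suc w)) (φ w)
  where
  lemma : ∀ v c a b → (1ℤ ℤ.+ v ℤ.- c) ℤ.* a ℤ.- (v ℤ.- c) ℤ.* b ≡
    (v ℤ.- c ℤ.+ 1ℤ) ℤ.* (a ℤ.- b) ℤ.+ 1ℤ ℤ.* b
  lemma = solve-∀
Δ^-linear-* (suc d) φ c w = trans
  (cong₂ ℤ._-_ (Δ^-linear-* d φ c (suc w)) (Δ^-linear-* d φ c w))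
  (lemma (+ w) c (+ suc d) (Δ^ d φ (suc (suc w))) (Δ^ d φ (suc w)) (Δ^ d φ w))
  where
  lemma : ∀ v c e a b f →
    ((1ℤ ℤ.+ v ℤ.- c ℤ.+ e) ℤ.* (a ℤ.- b) ℤ.+ e ℤ.* b) ℤ.- ((v ℤ.- c ℤ.+ e) ℤ.* (b ℤ.- f) ℤ.+ e ℤ.* f) ≡
    (v ℤ.- c ℤ.+ (1ℤ ℤ.+ e)) ℤ.* ((a ℤ.- b) ℤ.- (b ℤ.- f)) ℤ.+ (1ℤ ℤ.+ e) ℤ.* (b ℤ.- f)
  lemma = solve-∀

-- Exchanging adjacent coordinates

-- `N + 2` coordinates have `N + 1` adjacent pairs; `x` lists the coordinates outside the chosen
-- pair.
D : ∀ {N} → Fin (suc N) → (Subset (suc (suc N)) → ℤ) → Subset N → ℤ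
D zero    h x = h (inside ∷ outside ∷ x) ℤ.- h (outside ∷ inside ∷ x)
D (suc k) h (b ∷ x) = D k (λ y → h (b ∷ y)) x

D-cong : ∀ {N} (k : Fin (suc N)) {h g} → (∀ x → h x ≡ g x) → ∀ x → D k h x ≡ D k g x
D-cong zero    e x       = cong₂ ℤ._-_ (e _) (e _)
D-cong (suc k) e (b ∷ x) = D-cong k (λ y → e (b ∷ y)) x

D-− : ∀ {N} (k : Fin (suc N)) h g x → D k (λ y → h y ℤ.- g y) x ≡ D k h x ℤ.- D k g x
D-− zero    h g x = lemma (h (inside ∷ outside ∷ x)) (g (inside ∷ outside ∷ x)) (h (outside ∷ inside ∷ x)) (g (outside ∷ inside ∷ x))
  where
  lemma : ∀ a b c e → (a ℤ.- b) ℤ.- (c ℤ.- e) ≡ (a ℤ.- c) ℤ.- (b ℤ.- e)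
  lemma = solve-∀
D-− (suc k) h g (b ∷ x) = D-− k _ _ x

-- Writing h = u + αy + βz + δyz in the two exchanged variables, the difference is α - β, which has
-- one degree less than h.
Deg-D : ∀ {N} (k : Fin (suc N)) d h → Deg (suc (suc N)) (suc d) h → Deg N d (D k h)
Deg-D {N} zero d h ((_ , dΔ₀) , dΔ) =
  Deg-cong N d (λ x → lemma (h (inside ∷ outside ∷ x)) (h (outside ∷ outside ∷ x)) (h (outside ∷ inside ∷ x)))
    (Deg-− N d (Deg-outside N d dΔ) dΔ₀)
  where
  lemma : ∀ a b c → (a ℤ.- b) ℤ.- (c ℤ.- b) ≡ a ℤ.- c
  lemma = solve-∀
Deg-D {suc N} (suc k) zero    h (dh , hΔ) (outside ∷ x) = Deg-D k 0 (λ y → h (outside ∷ y)) dh x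
-- Degree below 1 makes the leading difference vanish, so the `outside` slice can stand in for the
-- `inside` one.
Deg-D {suc N} (suc k) zero    h (dh , hΔ) (inside ∷ x)  = trans
  (D-cong k (λ y → ℤ.i-j≡0⇒i≡j _ _ (hΔ y)) x) (Deg-D k 0 (λ y → h (outside ∷ y)) dh x)
Deg-D {suc N} (suc k) (suc d) h (dh , dΔ) =
  Deg-D k (suc d) (λ y → h (outside ∷ y)) dh ,
  Deg-cong N d (D-− k _ _) (Deg-D k d _ dΔ)

-- The sorted representative of size `w`, `inside` entries first; a `w` above `N` gives the full
-- set.
canonical : ∀ N → ℕ → Subset N
canonical zero    w       = []
canonical (suc N) zero    = outside ∷ canonical N zero
canonical (suc N) (suc w) = inside ∷ canonical N w

∣canonical∣ : ∀ {N w} → w ≤ N → ∣ canonical N w ∣ ≡ w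
∣canonical∣ {zero}  z≤n       = refl
∣canonical∣ {suc N} z≤n       = ∣canonical∣ {N} z≤n
∣canonical∣ {suc N} (s≤s w≤N) = cong suc (∣canonical∣ w≤N)

-- Linear functionals

-- Quantifying over w together with its pointwise description makes this respect pointwise equality.
Linear : ∀ {M} → ((Fin M → ℤ) → ℤ) → Set
Linear {M} φ = ∀ c u v w → (∀ i → w i ≡ c ℤ.* u i ℤ.+ v i) → φ w ≡ c ℤ.* φ u ℤ.+ φ v

Linear-0 : ∀ {M} {φ : (Fin M → ℤ) → ℤ} → Linear φ → φ (λ _ → 0ℤ) ≡ 0ℤ
Linear-0 {φ = φ} lin = trans
  (lin (ℤ.- 1ℤ) (λ _ → 0ℤ) (λ _ → 0ℤ) (λ _ → 0ℤ) (λ _ → refl)) (lemma (φ (λ _ → 0ℤ)))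
  where
  lemma : ∀ t → (ℤ.- 1ℤ) ℤ.* t ℤ.+ t ≡ 0ℤ
  lemma = solve-∀

Linear-0∷ : ∀ {M} {φ : (Fin (suc M) → ℤ) → ℤ} → Linear φ → Linear (λ a → φ (0ℤ ◂ a))
Linear-0∷ lin c u v w e = lin c (0ℤ ◂ u) (0ℤ ◂ v) (0ℤ ◂ w) λ where
  zero    → sym (trans (ℤ.+-identityʳ (c ℤ.* 0ℤ)) (ℤ.*-zeroʳ c))
  (suc i) → e i

Linear-+ : ∀ {M} {φ ψ : (Fin M → ℤ) → ℤ} → Linear φ → Linear ψ → Linear (λ a → φ a ℤ.+ ψ a)
Linear-+ {φ = φ} {ψ} lφ lψ c u v w e = trans
  (cong₂ ℤ._+_ (lφ c u v w e) (lψ c u v w e)) (lemma c (φ u) (φ v) (ψ u) (ψ v))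
  where
  lemma : ∀ c a b f g → (c ℤ.* a ℤ.+ b) ℤ.+ (c ℤ.* f ℤ.+ g) ≡ c ℤ.* (a ℤ.+ f) ℤ.+ (b ℤ.+ g)
  lemma = solve-∀

Linear-* : ∀ {M} {φ : (Fin M → ℤ) → ℤ} k → Linear φ → Linear (λ a → k ℤ.* φ a)
Linear-* {φ = φ} k lφ c u v w e = trans (cong (k ℤ.*_) (lφ c u v w e)) (lemma k c (φ u) (φ v))
  where
  lemma : ∀ k c a b → k ℤ.* (c ℤ.* a ℤ.+ b) ≡ c ℤ.* (k ℤ.* a) ℤ.+ k ℤ.* b
  lemma = solve-∀

Linear-lookup : ∀ {M} (i : Fin M) → Linear (λ a → a i)
Linear-lookup i c u v w e = e i

Linear-reindex : ∀ {M M′} {φ : (Fin M → ℤ) → ℤ} (σ : Fin M → Fin M′) → Linear φ → Linear (λ a → φ (a ∘ σ))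
Linear-reindex σ lin c u v w e = lin c (u ∘ σ) (v ∘ σ) (w ∘ σ) (e ∘ σ)

Linear-poly : ∀ N d x → Linear (λ a → poly N d a x)
Linear-poly N       zero    x             = λ c u v w e → sym (trans (ℤ.+-identityʳ (c ℤ.* 0ℤ)) (ℤ.*-zeroʳ c))
Linear-poly zero    (suc d) []            = Linear-lookup zero
Linear-poly (suc N) (suc d) (outside ∷ x) = Linear-reindex (_↑ˡ dim N d) (Linear-poly N (suc d) x)
Linear-poly (suc N) (suc d) (inside ∷ x)  = Linear-+
  (Linear-reindex (dim N (suc d) ↑ʳ_) (Linear-poly N d x))
  (Linear-reindex (_↑ˡ dim N d) (Linear-poly N (suc d) x))

comb : ∀ {m} → (Fin m → ℤ) → (Fin m → ℤ) → ℤ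
comb {zero}  f a = 0ℤ
comb {suc m} f a = f zero ℤ.* a zero ℤ.+ comb (f ∘ suc) (a ∘ suc)

Linear-comb : ∀ {m} (f : Fin m → ℤ) → Linear (comb f)
Linear-comb {zero}  f = λ c u v w e → sym (trans (ℤ.+-identityʳ (c ℤ.* 0ℤ)) (ℤ.*-zeroʳ c))
Linear-comb {suc m} f = Linear-+ (Linear-* (f zero) (Linear-lookup zero)) (Linear-reindex suc (Linear-comb (f ∘ suc)))

Deg-comb : ∀ N d {m} (F : Fin m → Subset N → ℤ) a → (∀ i → Deg N d (F i)) →
  Deg N d (λ x → comb (λ i → F i x) a)
Deg-comb N d {zero}  F a dF = Deg-0 N d
Deg-comb N d {suc m} F a dF = Deg-+ N d
  (Deg-cong N d (λ x → ℤ.*-comm (a zero) (F zero x)) (Deg-scale N d (a zero) (dF zero)))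
  (Deg-comb N d (F ∘ suc) (a ∘ suc) (dF ∘ suc))

splitAt-elim : ∀ m {n} (P : Fin (m + n) → Set) → (∀ i → P (i ↑ˡ n)) → (∀ j → P (m ↑ʳ j)) → ∀ i → P i
splitAt-elim m {n} P l r i with splitAt m i in eq
... | inj₁ j = subst P (Fin.splitAt⁻¹-↑ˡ eq) (l j)
... | inj₂ j = subst P (Fin.splitAt⁻¹-↑ʳ eq) (r j)

-- Polynomials with prescribed roots

prodLin-pred : ∀ ηs v → prodLin (List.map ℤ.pred ηs) v ≡ prodLin ηs (1ℤ ℤ.+ v)
prodLin-pred []       v = refl
prodLin-pred (η ∷ ηs) v = cong₂ ℤ._*_ (lemma v η) (prodLin-pred ηs v)
  where
  lemma : ∀ v η → v ℤ.- ((ℤ.- 1ℤ) ℤ.+ η) ≡ (1ℤ ℤ.+ v) ℤ.- η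
  lemma = solve-∀

-- The offset `o` is the integer that index 0 stands for. It advances along the vector; starting at
-- -1 instead of 0 gives the shifted set K - 1.
roots : ∀ {q} → Subset q → ℤ → List ℤ
roots []            o = []
roots (outside ∷ S) o = roots S (1ℤ ℤ.+ o)
roots (inside  ∷ S) o = o ∷ roots S (1ℤ ℤ.+ o)

length-roots : ∀ {q} (S : Subset q) o → length (roots S o) ≡ ∣ S ∣
length-roots []            o = refl
length-roots (outside ∷ S) o = length-roots S (1ℤ ℤ.+ o)
length-roots (inside  ∷ S) o = cong suc (length-roots S (1ℤ ℤ.+ o))

-- Inserting the first point into `T` matters only if `S` contains it and `T` does not. This
-- controls the substitution x₁ = 1 at a member of the family.
∣∩inside∷tail∣ : ∀ {N} (S T : Subset (suc N)) → head T ≡ inside ⊎ head S ≡ outside →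
  ∣ S ∩ (inside ∷ tail T) ∣ ≡ ∣ S ∩ T ∣
∣∩inside∷tail∣ (s ∷ S)       (inside ∷ T) (inj₁ refl) = refl
∣∩inside∷tail∣ (outside ∷ S) (t ∷ T)      (inj₂ refl) = refl

head-cases : ∀ {N} (S : Subset (suc N)) → head S ≡ inside ⊎ head S ≡ outside
head-cases (inside  ∷ S) = inj₁ refl
head-cases (outside ∷ S) = inj₂ refl

-- Vanishing modulo p

module Modulo (p : ℕ) (pr : Prime p) where

  Null : ℤ → Set
  Null x = + p ∣ℤ x

  Null-0 : Null 0ℤ
  Null-0 = divides 0ℤ refl

  ≡0⇒Null : ∀ {x} → x ≡ 0ℤ → Null x
  ≡0⇒Null refl = Null-0

  Null-prime : ∀ x y → Null (x ℤ.* y) → Null x ⊎ Null y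
  Null-prime x y xy = Sum.map ∣ᵤ⇒∣ ∣ᵤ⇒∣
    (euclidsLemma ℤ.∣ x ∣ ℤ.∣ y ∣ pr (subst (p ∣ℕ_) (ℤ.abs-* x y) (∣⇒∣ᵤ xy)))

  Null-cancel : ∀ x y → ¬ Null x → Null (x ℤ.* y) → Null y
  Null-cancel x y ¬x xy with Null-prime x y xy
  ... | inj₁ x0 = ⊥-elim (¬x x0)
  ... | inj₂ y0 = y0

  ¬Null-small : ∀ {d} → suc d < p → ¬ Null (+ suc d)
  ¬Null-small d<p p∣d = ℕ.<⇒≱ d<p (∣⇒≤ (∣⇒∣ᵤ p∣d))

  ¬Null-1 : ¬ Null 1ℤ
  ¬Null-1 = ¬Null-small (nonTrivial⇒n>1 p {{prime⇒nonTrivial pr}})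

  Null-prodLin⁻ : ∀ ηs v → Null (prodLin ηs v) → Any (λ η → Null (v ℤ.- η)) ηs
  Null-prodLin⁻ []       v 1∣ = ⊥-elim (¬Null-1 1∣)
  Null-prodLin⁻ (η ∷ ηs) v z  with Null-prime (v ℤ.- η) (prodLin ηs v) z
  ... | inj₁ z₁ = here z₁
  ... | inj₂ z₂ = there (Null-prodLin⁻ ηs v z₂)

  Null-prodLin⁺ : ∀ ηs v → Any (λ η → Null (v ℤ.- η)) ηs → Null (prodLin ηs v)
  Null-prodLin⁺ (η ∷ ηs) v (here z)  = ∣m⇒∣m*n (prodLin ηs v) z
  Null-prodLin⁺ (η ∷ ηs) v (there z) = ∣n⇒∣m*n (v ℤ.- η) (Null-prodLin⁺ ηs v z)

  -- Induction settles the `outside` slice; then the leading difference is null at the low points of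
  -- the smaller degree, hence everywhere, which settles the `inside` slice.
  Null-lowPoints : ∀ N d {f} → Deg N d f → All (λ x → Null (f x)) (lowPoints N d) → ∀ x → Null (f x)
  Null-lowPoints N       zero    f0        _        x  = ≡0⇒Null (f0 x)
  Null-lowPoints zero    (suc d) _         (z ∷ []) [] = z
  Null-lowPoints (suc N) (suc d) {f} (df , dΔ) zs = λ where
      (outside ∷ x) → out x
      (inside  ∷ x) → ∣m+n∣n⇒∣m {m = f (inside ∷ x)}
        (Null-lowPoints N d dΔ (All.zipWith (λ (z , y) → ∣m∣n⇒∣m-n z y) (All.map⁻ zs₁ , All.universal out _)) x)
        (∣m⇒∣-m (out x))
    where
    zs₀ = All.++⁻ˡ (List.map (outside ∷_) (lowPoints N (suc d))) zs
    zs₁ = All.++⁻ʳ (List.map (outside ∷_) (lowPoints N (suc d))) zs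
    out : ∀ x → Null (f (outside ∷ x))
    out = Null-lowPoints N (suc d) df (All.map⁻ zs₀)

  -- The `outside` slice sees only coefficients without the first variable; subtracting it from the
  -- `inside` slice isolates the others.
  poly-independent : ∀ N d a → (∀ x → Null (poly N d a x)) → ∀ i → Null (a i)
  poly-independent zero    (suc d) a z zero = z []
  poly-independent (suc N) (suc d) a z = splitAt-elim (dim N (suc d)) (λ i → Null (a i))
    (poly-independent N (suc d) _ (λ x → z (outside ∷ x)))
    (poly-independent N d _ (λ x → ∣m+n∣n⇒∣m (z (inside ∷ x)) (z (outside ∷ x))))

  comb-Null : ∀ {m} f (a : Fin m → ℤ) → (∀ i → Null (f i ℤ.* a i)) → Null (comb f a)
  comb-Null {zero}  f a z = Null-0
  comb-Null {suc m} f a z = ∣m∣n⇒∣m+n (z zero) (comb-Null (f ∘ suc) (a ∘ suc) (z ∘ suc))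

  comb-isolate : ∀ {m} f (a : Fin m → ℤ) j → Null (comb f a) →
    (∀ i → ¬ i ≡ j → Null (f i ℤ.* a i)) → Null (f j ℤ.* a j)
  comb-isolate f a zero    z zs = ∣m+n∣n⇒∣m z
    (comb-Null (f ∘ suc) (a ∘ suc) (λ i → zs (suc i) λ ()))
  comb-isolate f a (suc j) z zs = comb-isolate (f ∘ suc) (a ∘ suc) j (∣m+n∣m⇒∣n z (zs zero λ ()))
    (λ i i≢j → zs (suc i) (i≢j ∘ Fin.suc-injective))

  -- Dimension comparison modulo p

  -- A division-free way to say that one functional cuts the dimension by at most one: `ι` is an
  -- integral linear map that stays injective modulo p.
  record Kernel {M} (φ : (Fin (suc M) → ℤ) → ℤ) : Set where
    field
      ι         : (Fin M → ℤ) → Fin (suc M) → ℤ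
      linear    : ∀ i → Linear (λ a → ι a i)
      inKernel  : ∀ a → Null (φ (ι a))
      injective : ∀ a → (∀ i → Null (ι a i)) → ∀ i → Null (a i)

  kernel : ∀ {M} (φ : (Fin (suc M) → ℤ) → ℤ) → Linear φ → Kernel φ
  kernel {M} φ lin with + p ∣? φ (1ℤ ◂ λ _ → 0ℤ)
  kernel {M} φ lin | no q≢0 = record
    { ι         = ι
    ; linear    = λ where
        zero    c u v w e → trans (cong ℤ.-_ (Linear-0∷ lin c u v w e)) (neg c (t u) (t v))
        (suc i) c u v w e → trans (cong (q ℤ.*_) (e i)) (scale q c (u i) (v i))
    ; inKernel  = λ a → ≡0⇒Null (φι≡0 a)
    ; injective = λ a z i → Null-cancel q (a i) q≢0 (z (suc i))
    }
    where
    q = φ (1ℤ ◂ λ _ → 0ℤ)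
    t : (Fin M → ℤ) → ℤ
    t a = φ (0ℤ ◂ a)
    ι : (Fin M → ℤ) → Fin (suc M) → ℤ
    -- Solving for coordinate 0 would divide by the pivot `q`; instead the free coordinates are
    -- multiplied by `q`.
    ι a = (ℤ.- t a) ◂ λ i → q ℤ.* a i
    neg : ∀ c x y → ℤ.- (c ℤ.* x ℤ.+ y) ≡ c ℤ.* (ℤ.- x) ℤ.+ (ℤ.- y)
    neg = solve-∀
    scale : ∀ q c x y → q ℤ.* (c ℤ.* x ℤ.+ y) ≡ c ℤ.* (q ℤ.* x) ℤ.+ q ℤ.* y
    scale = solve-∀
    e₀ : ∀ q t → ℤ.- t ≡ q ℤ.* 0ℤ ℤ.+ (ℤ.- t)
    e₀ = solve-∀
    e₁ : ∀ t → ℤ.- t ≡ (ℤ.- t) ℤ.* 1ℤ ℤ.+ 0ℤ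
    e₁ = solve-∀
    e₂ : ∀ t → 0ℤ ≡ (ℤ.- t) ℤ.* 0ℤ ℤ.+ 0ℤ
    e₂ = solve-∀
    e₃ : ∀ q t → q ℤ.* t ℤ.+ ((ℤ.- t) ℤ.* q ℤ.+ 0ℤ) ≡ 0ℤ
    e₃ = solve-∀
    φι≡0 : ∀ a → φ (ι a) ≡ 0ℤ
    φι≡0 a = begin
      φ (ι a)
        ≡⟨ lin q (0ℤ ◂ a) ((ℤ.- t a) ◂ λ _ → 0ℤ) (ι a) (λ { zero → e₀ q (t a) ; (suc i) → sym (ℤ.+-identityʳ _) }) ⟩
      q ℤ.* t a ℤ.+ φ ((ℤ.- t a) ◂ λ _ → 0ℤ)
        ≡⟨ cong (ℤ._+_ (q ℤ.* t a)) (lin (ℤ.- t a) (1ℤ ◂ λ _ → 0ℤ) (λ _ → 0ℤ) _ (λ { zero → e₁ (t a) ; (suc i) → e₂ (t a) })) ⟩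
      q ℤ.* t a ℤ.+ ((ℤ.- t a) ℤ.* q ℤ.+ φ (λ _ → 0ℤ))
        ≡⟨ cong (λ z → q ℤ.* t a ℤ.+ ((ℤ.- t a) ℤ.* q ℤ.+ z)) (Linear-0 lin) ⟩
      q ℤ.* t a ℤ.+ ((ℤ.- t a) ℤ.* q ℤ.+ 0ℤ)
        ≡⟨ e₃ q (t a) ⟩
      0ℤ ∎
      where open ≡-Reasoning
  kernel {zero} φ lin | yes q0 = record
    { ι         = λ _ _ → 0ℤ
    ; linear    = λ i c u v w e → sym (trans (ℤ.+-identityʳ (c ℤ.* 0ℤ)) (ℤ.*-zeroʳ c))
    ; inKernel  = λ a → ≡0⇒Null (Linear-0 lin)
    ; injective = λ a z ()
    }
  -- With a null pivot the first unit vector is in the kernel, so coordinate 0 stays free and only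
  -- the others are solved recursively.
  kernel {suc M} φ lin | yes q0 = record
    { ι         = λ a → a zero ◂ K.ι (a ∘ suc)
    ; linear    = λ where
        zero    → Linear-lookup zero
        (suc i) → Linear-reindex suc (K.linear i)
    ; inKernel  = λ a → subst Null
        (sym (lin (a zero) (1ℤ ◂ λ _ → 0ℤ) (0ℤ ◂ K.ι (a ∘ suc)) _
          (λ { zero → e₀ (a zero) ; (suc i) → e₁ (a zero) (K.ι (a ∘ suc) i) })))
        (∣m∣n⇒∣m+n (∣n⇒∣m*n (a zero) q0) (K.inKernel (a ∘ suc)))
    ; injective = λ where
        a z zero    → z zero
        a z (suc i) → K.injective (a ∘ suc) (z ∘ suc) i
    }
    where
    module K = Kernel (kernel (λ a → φ (0ℤ ◂ a)) (Linear-0∷ lin))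
    e₀ : ∀ x → x ≡ x ℤ.* 1ℤ ℤ.+ 0ℤ
    e₀ = solve-∀
    e₁ : ∀ x y → y ≡ x ℤ.* 0ℤ ℤ.+ y
    e₁ = solve-∀

  -- Passing to the kernel of one functional after another costs one dimension each.
  injective⇒≤ : ∀ {X : Set} {M} (T : X → (Fin M → ℤ) → ℤ) → (∀ x → Linear (T x)) → (xs : List X) →
    (∀ a → All (λ x → Null (T x a)) xs → ∀ i → Null (a i)) → M ≤ length xs
  injective⇒≤ {M = zero}  T lin xs       inj = z≤n
  -- With no functional left the constant vector 1 meets every condition, yet it is not null.
  injective⇒≤ {M = suc M} T lin []       inj = ⊥-elim (¬Null-1 (inj (λ _ → 1ℤ) [] zero))
  injective⇒≤ {M = suc M} T lin (x ∷ xs) inj = s≤s (injective⇒≤ (λ y a → T y (K.ι a))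
    (λ y c u v w e → lin y c (K.ι u) (K.ι v) (K.ι w) (λ i → K.linear i c u v w e)) xs
    (λ a z → K.injective a (inj (K.ι a) (K.inKernel a ∷ z))))
    where module K = Kernel (kernel (T x) (lin x))

  -- Cancelling linear factors from functions of the size

  Null-Δ^ : ∀ {N φ} → (∀ w → w ≤ N → Null (φ w)) → ∀ d w → w + d ≤ N → Null (Δ^ d φ w)
  Null-Δ^ {N} z zero    w w≤N = z w (subst (_≤ N) (ℕ.+-identityʳ w) w≤N)
  Null-Δ^ {N} z (suc d) w w≤N = ∣m∣n⇒∣m-n
    (Null-Δ^ z d (suc w) (subst (_≤ N) (ℕ.+-suc w d) w≤N))
    (Null-Δ^ z d w (ℕ.≤-trans (ℕ.+-monoʳ-≤ w (ℕ.n≤1+n d)) w≤N))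

  -- For d > 0 the Leibniz rule expresses d times the difference of order d - 1 through null
  -- quantities; d < p lets the factor d be cancelled, and the order descends to 0.
  cancel-linear : ∀ {N} d φ c → d < p → d ≤ N →
    (∀ w → w + d ≤ N → Null (Δ^ d φ w)) →
    (∀ w → w ≤ N → Null ((+ w ℤ.- c) ℤ.* φ w)) → ∀ w → w ≤ N → Null (φ w)
  cancel-linear {N} zero    φ c d<p d≤N zΔ z w w≤N = zΔ w (subst (_≤ N) (sym (ℕ.+-identityʳ w)) w≤N)
  cancel-linear {N} (suc d) φ c d<p d≤N zΔ z =
    cancel-linear d φ c (ℕ.<⇒≤ d<p) (ℕ.<⇒≤ d≤N) lower z
    where
    lower′ : ∀ w → w + suc d ≤ N → Null (Δ^ d φ w)
    lower′ w w≤ = Null-cancel (+ suc d) (Δ^ d φ w) (¬Null-small d<p)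
      (∣m+n∣m⇒∣n (subst Null (Δ^-linear-* d φ c w) (Null-Δ^ z (suc d) w w≤)) (∣n⇒∣m*n (+ w ℤ.- c ℤ.+ + suc d) (zΔ w w≤)))
    lower : ∀ w → w + d ≤ N → Null (Δ^ d φ w)
    -- The window for order `d` has one more point than `lower′` reaches. Past `w = 0` each value
    -- follows from its predecessor, since the next difference is null.
    lower zero    _  = lower′ zero d≤N
    lower (suc w) w≤ = ∣m+n∣n⇒∣m (zΔ w w≤′) (∣m⇒∣-m (lower′ w w≤′))
      where w≤′ = subst (_≤ N) (sym (ℕ.+-suc w d)) w≤

  -- A linear factor raises the order of the null difference by one. So induction applies to `ψ`,
  -- and `cancel-linear` then removes `η`. The orders passed to `cancel-linear` end at
  -- `d + length ηs − 1`, hence the two bounds.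
  cancel-prodLin : ∀ {N} ηs d φ → d + length ηs ≤ p → d + length ηs ≤ suc N →
    (∀ w → w + d ≤ N → Null (Δ^ d φ w)) →
    (∀ w → w ≤ N → Null (prodLin ηs (+ w) ℤ.* φ w)) → ∀ w → w ≤ N → Null (φ w)
  cancel-prodLin     []       d φ d≤p d≤N zΔ z w w≤N = subst Null (ℤ.*-identityˡ (φ w)) (z w w≤N)
  cancel-prodLin {N} (η ∷ ηs) d φ d≤p d≤N zΔ z =
    cancel-linear d φ η (ℕ.≤-trans (s≤s (ℕ.m≤m+n d _)) d≤p′) (s≤s⁻¹ (ℕ.≤-trans (s≤s (ℕ.m≤m+n d _)) d≤N′)) zΔ
      (cancel-prodLin ηs (suc d) ψ d≤p′ d≤N′ zΔψ zψ)
    where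
    ψ : ℕ → ℤ
    ψ w = (+ w ℤ.- η) ℤ.* φ w
    d≤p′ = subst (_≤ p) (ℕ.+-suc d (length ηs)) d≤p
    d≤N′ = subst (_≤ suc N) (ℕ.+-suc d (length ηs)) d≤N
    zΔψ : ∀ w → w + suc d ≤ N → Null (Δ^ (suc d) ψ w)
    zΔψ w w≤ = subst Null (sym (Δ^-linear-* d φ η w)) (∣m∣n⇒∣m+n
      (∣n⇒∣m*n (+ w ℤ.- η ℤ.+ + suc d) (∣m∣n⇒∣m-n (zΔ (suc w) (subst (_≤ N) (ℕ.+-suc w d) w≤)) zw)) (∣n⇒∣m*n (+ suc d) zw))
      where zw = zΔ w (ℕ.≤-trans (ℕ.+-monoʳ-≤ w (ℕ.n≤1+n d)) w≤)
    lemma : ∀ a b c → (a ℤ.* b) ℤ.* c ≡ b ℤ.* (a ℤ.* c)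
    lemma = solve-∀
    zψ : ∀ w → w ≤ N → Null (prodLin ηs (+ w) ℤ.* ψ w)
    zψ w w≤ = subst Null (lemma (+ w ℤ.- η) (prodLin ηs (+ w)) (φ w)) (z w w≤)

  -- The leading difference of `h` has one degree less and is congruent to `Δ φ` at the size of the
  -- remaining set.
  Null-Δ^-Deg : ∀ N d {h φ} → Deg N d h → (∀ x → Null (h x ℤ.- φ ∣ x ∣)) →
    ∀ w → w + d ≤ N → Null (Δ^ d φ w)
  Null-Δ^-Deg N zero {h} {φ} h0 z w w≤ =
    subst (λ k → Null (φ k)) (∣canonical∣ w≤N) (subst Null (lemma _ _ (h0 x)) (∣m⇒∣-m (z x)))
    where
    w≤N = subst (_≤ N) (ℕ.+-identityʳ w) w≤
    x = canonical N w
    lemma : ∀ a b → a ≡ 0ℤ → ℤ.- (a ℤ.- b) ≡ b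
    lemma a b refl = lemma′ b
      where
      lemma′ : ∀ b → ℤ.- (0ℤ ℤ.- b) ≡ b
      lemma′ = solve-∀
  Null-Δ^-Deg zero    (suc d) dh z w w≤ = ⊥-elim (ℕ.m+1+n≰m 0 (ℕ.≤-trans (ℕ.m≤n+m (suc d) w) w≤))
  Null-Δ^-Deg (suc N) (suc d) {h} {φ} (_ , dΔ) z w w≤ = subst Null (Δ^-Δ d φ w)
    (Null-Δ^-Deg N d dΔ
      (λ x → subst Null (lemma (h (inside ∷ x)) (φ (suc ∣ x ∣)) (h (outside ∷ x)) (φ ∣ x ∣))
        (∣m∣n⇒∣m-n (z (inside ∷ x)) (z (outside ∷ x))))
      w (s≤s⁻¹ (subst (_≤ suc N) (ℕ.+-suc w d) w≤)))
    where
    lemma : ∀ a b c e → (a ℤ.- b) ℤ.- (c ℤ.- e) ≡ (a ℤ.- c) ℤ.- (b ℤ.- e)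
    lemma = solve-∀

  -- Symmetric functions modulo p

  Symmetric : ∀ N → (Subset N → ℤ) → Set
  Symmetric zero          h = ⊤
  Symmetric (suc zero)    h = ⊤
  Symmetric (suc (suc N)) h = ∀ (k : Fin (suc N)) x → Null (D k h x)

  Symmetric-∷ : ∀ N {h} b → Symmetric (suc N) h → Symmetric N (λ x → h (b ∷ x))
  Symmetric-∷ zero          b _ = tt
  Symmetric-∷ (suc zero)    b _ = tt
  Symmetric-∷ (suc (suc N)) b s = λ k x → s (suc k) (b ∷ x)

  Null-refl : ∀ a → Null (a ℤ.- a)
  Null-refl a = ≡0⇒Null (ℤ.+-inverseʳ a)

  Null-sym : ∀ a b → Null (a ℤ.- b) → Null (b ℤ.- a)
  Null-sym a b ab = subst Null (lemma a b) (∣m⇒∣-m ab)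
    where
    lemma : ∀ a b → ℤ.- (a ℤ.- b) ≡ b ℤ.- a
    lemma = solve-∀

  Null-trans : ∀ a b c → Null (a ℤ.- b) → Null (b ℤ.- c) → Null (a ℤ.- c)
  Null-trans a b c ab bc = subst Null (lemma a b c) (∣m∣n⇒∣m+n ab bc)
    where
    lemma : ∀ a b c → (a ℤ.- b) ℤ.+ (b ℤ.- c) ≡ a ℤ.- c
    lemma = solve-∀

  -- Adjacent exchanges carry the leading `outside` past the `inside` entries one at a time.
  Symmetric-outside∷canonical : ∀ N w {h} → Symmetric (suc N) h → w ≤ N →
    Null (h (outside ∷ canonical N w) ℤ.- h (canonical (suc N) w))
  Symmetric-outside∷canonical N       zero    {h} s _         = Null-refl (h (canonical (suc N) zero))
  Symmetric-outside∷canonical (suc N) (suc w) {h} s (s≤s w≤N) = Null-trans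
    (h (outside ∷ inside ∷ c)) (h (inside ∷ outside ∷ c)) (h (inside ∷ canonical (suc N) w))
    (Null-sym (h (inside ∷ outside ∷ c)) (h (outside ∷ inside ∷ c)) (s zero c))
    (Symmetric-outside∷canonical N w (Symmetric-∷ (suc N) inside s) w≤N)
    where c = canonical N w

  -- Insertion sort: the tail is sorted first, then the head is moved into place.
  Symmetric-canonical : ∀ N {h} → Symmetric N h → ∀ x → Null (h x ℤ.- h (canonical N ∣ x ∣))
  Symmetric-canonical zero    {h} s []            = Null-refl (h [])
  Symmetric-canonical (suc N) {h} s (inside ∷ x)  = Symmetric-canonical N (Symmetric-∷ N inside s) x
  Symmetric-canonical (suc N) {h} s (outside ∷ x) = Null-trans
    (h (outside ∷ x)) (h (outside ∷ canonical N ∣ x ∣)) (h (canonical (suc N) ∣ x ∣))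
    (Symmetric-canonical N (Symmetric-∷ N outside s) x)
    (Symmetric-outside∷canonical N ∣ x ∣ s (∣p∣≤n x))

  -- Both exchanged points have size `suc ∣ x ∣`, so the factor comes out of the difference.
  Null-*-D : ∀ {N} (k : Fin (suc N)) (γ : ℕ → ℤ) h → (∀ x → Null (γ ∣ x ∣ ℤ.* h x)) →
    ∀ x → Null (γ (suc ∣ x ∣) ℤ.* D k h x)
  Null-*-D zero γ h z x = subst Null
    (lemma (γ (suc ∣ x ∣)) (h (inside ∷ outside ∷ x)) (h (outside ∷ inside ∷ x)))
    (∣m∣n⇒∣m-n (z (inside ∷ outside ∷ x)) (z (outside ∷ inside ∷ x)))
    where
    lemma : ∀ c a b → c ℤ.* a ℤ.- c ℤ.* b ≡ c ℤ.* (a ℤ.- b)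
    lemma = solve-∀
  Null-*-D (suc k) γ h z (outside ∷ x) = Null-*-D k γ (λ y → h (outside ∷ y)) (λ y → z (outside ∷ y)) x
  -- The fixed `inside` entry raises every size by one, which `γ ∘ suc` absorbs.
  Null-*-D (suc k) γ h z (inside ∷ x)  = Null-*-D k (γ ∘ suc) (λ y → h (inside ∷ y)) (λ y → z (inside ∷ y)) x

  -- An exchange uses up two coordinates and lowers `e` by one, whence `2 * e` in the first bound.
  -- At order `suc e` the two bounds supply those of `cancel-prodLin`.
  cancel-prodLin-cube : ∀ e N ηs {h} → Deg N (suc e) h → 2 * e + length ηs ≤ N → e + length ηs < p →
    (∀ x → Null (prodLin ηs (+ ∣ x ∣) ℤ.* h x)) → ∀ x → Null (h x)
  cancel-prodLin-cube e N ηs {h} dh e≤N e<p z x = subst Null (lemma (h x) (φ ∣ x ∣))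
    (∣m∣n⇒∣m+n (canon x) (cancel-prodLin ηs (suc e) φ e<p
      (s≤s (ℕ.≤-trans (ℕ.+-monoˡ-≤ (length ηs) (ℕ.m≤m+n e _)) e≤N))
      (Null-Δ^-Deg N (suc e) dh canon)
      (λ w w≤N → subst (λ k → Null (prodLin ηs (+ k) ℤ.* φ w)) (∣canonical∣ w≤N) (z (canonical N w)))
      ∣ x ∣ (∣p∣≤n x)))
    where
    lemma : ∀ a b → (a ℤ.- b) ℤ.+ b ≡ a
    lemma = solve-∀
    φ : ℕ → ℤ
    φ w = h (canonical N w)
    symmetric : ∀ e N {h} → Deg N (suc e) h → 2 * e + length ηs ≤ N → e + length ηs < p →
      (∀ x → Null (prodLin ηs (+ ∣ x ∣) ℤ.* h x)) → Symmetric N h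
    symmetric e       zero          dh e≤N e<p z = tt
    symmetric e       (suc zero)    dh e≤N e<p z = tt
    symmetric zero    (suc (suc N)) {h} dh e≤N e<p z k x = ≡0⇒Null (Deg-D k 0 h dh x)
    symmetric (suc e) (suc (suc N)) {h} dh e≤N e<p z k =
      cancel-prodLin-cube e N (List.map ℤ.pred ηs) (Deg-D k (suc e) h dh)
        (subst (λ l → 2 * e + l ≤ N) (sym (List.length-map ℤ.pred ηs)) e≤N′)
        (subst (λ l → e + l < p) (sym (List.length-map ℤ.pred ηs)) (ℕ.<⇒≤ e<p))
        (λ x → subst (λ t → Null (t ℤ.* D k h x)) (sym (prodLin-pred ηs (+ ∣ x ∣)))
          (Null-*-D k (λ w → prodLin ηs (+ w)) h z x))
      where
      e≤N′ : 2 * e + length ηs ≤ N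
      e≤N′ = s≤s⁻¹ (s≤s⁻¹ (subst (λ t → t + length ηs ≤ suc (suc N)) (ℕ.*-suc 2 e) e≤N))
    canon : ∀ x → Null (h x ℤ.- φ ∣ x ∣)
    canon = Symmetric-canonical N (symmetric e N dh e≤N e<p z)

  -- Residue sets as root lists

  roots-shift : ∀ v o t → v ℤ.- (o ℤ.+ (1ℤ ℤ.+ t)) ≡ v ℤ.- ((1ℤ ℤ.+ o) ℤ.+ t)
  roots-shift = solve-∀

  roots⁺ : ∀ {q} (S : Subset q) o v {x} → x ∈ S → Null (v ℤ.- (o ℤ.+ + toℕ x)) →
    Any (λ η → Null (v ℤ.- η)) (roots S o)
  roots⁺ (inside  ∷ S) o v here z = here (subst (λ t → Null (v ℤ.- t)) (ℤ.+-identityʳ o) z)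
  roots⁺ (inside  ∷ S) o v {suc x} (there x∈S) z = there (roots⁺ S (1ℤ ℤ.+ o) v x∈S (subst Null (roots-shift v o (+ toℕ x)) z))
  roots⁺ (outside ∷ S) o v {suc x} (there x∈S) z = roots⁺ S (1ℤ ℤ.+ o) v x∈S (subst Null (roots-shift v o (+ toℕ x)) z)

  roots⁻ : ∀ {q} (S : Subset q) o v → Any (λ η → Null (v ℤ.- η)) (roots S o) →
    ∃ λ x → x ∈ S × Null (v ℤ.- (o ℤ.+ + toℕ x))
  roots⁻ (inside  ∷ S) o v (here z) = zero , here , subst (λ t → Null (v ℤ.- t)) (sym (ℤ.+-identityʳ o)) z
  roots⁻ (inside  ∷ S) o v (there z) with roots⁻ S (1ℤ ℤ.+ o) v z
  ... | x , x∈S , z′ = suc x , there x∈S , subst Null (sym (roots-shift v o (+ toℕ x))) z′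
  roots⁻ (outside ∷ S) o v z with roots⁻ S (1ℤ ℤ.+ o) v z
  ... | x , x∈S , z′ = suc x , there x∈S , subst Null (sym (roots-shift v o (+ toℕ x))) z′

  Null-modP : ∀ x → Null (+ x ℤ.- + toℕ (modP p pr x))
  Null-modP x = divides (+ (x / p)) (begin
    + x ℤ.- + toℕ (modP p pr x)                  ≡⟨ cong (λ t → + x ℤ.- + t) (Fin.toℕ-fromℕ< (m%n<n x p)) ⟩
    + x ℤ.- + (x % p)                            ≡⟨ cong (λ t → + t ℤ.- + (x % p)) (m≡m%n+[m/n]*n x p) ⟩
    + (x % p) ℤ.+ + (x / p * p) ℤ.- + (x % p)    ≡⟨ lemma (+ (x % p)) (+ (x / p * p)) ⟩
    + (x / p * p)                                ≡⟨ ℤ.pos-* (x / p) p ⟩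
    + (x / p) ℤ.* + p                            ∎)
    where
    open ≡-Reasoning
    instance _ = prime⇒nonZero pr
    lemma : ∀ a b → a ℤ.+ b ℤ.- a ≡ b
    lemma = solve-∀

  Null-toℕ-injective : ∀ (i j : Fin p) → Null (+ toℕ i ℤ.- + toℕ j) → i ≡ j
  Null-toℕ-injective i j z = Fin.toℕ-injective (ℤ.+-injective (ℤ.i-j≡0⇒i≡j (+ toℕ i) (+ toℕ j)
    (ℤ.∣i∣≡0⇒i≡0 (small (∣⇒∣ᵤ z) bound))))
    where
    small : ∀ {k} → p ∣ℕ k → k < p → k ≡ 0
    small {zero}  _   _   = refl
    small {suc k} p∣k k<p = ⊥-elim (ℕ.<⇒≱ k<p (∣⇒≤ p∣k))
    bound : ℤ.∣ + toℕ i ℤ.- + toℕ j ∣ < p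
    bound = subst (λ t → ℤ.∣ t ∣ < p) (sym (ℤ.m-n≡m⊖n (toℕ i) (toℕ j)))
      (ℕ.≤-<-trans (ℤ.∣m⊝n∣≤m⊔n (toℕ i) (toℕ j)) (ℕ.⊔-lub (Fin.toℕ<n i) (Fin.toℕ<n j)))

  modP∈⇒Null : ∀ S x → modP p pr x ∈ S → Null (prodLin (roots S 0ℤ) (+ x))
  modP∈⇒Null S x x∈S = Null-prodLin⁺ (roots S 0ℤ) (+ x) (roots⁺ S 0ℤ (+ x) x∈S (Null-modP x))

  Null⇒modP∈ : ∀ S x → Null (prodLin (roots S 0ℤ) (+ x)) → modP p pr x ∈ S
  Null⇒modP∈ S x z with roots⁻ S 0ℤ (+ x) (Null-prodLin⁻ (roots S 0ℤ) (+ x) z)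
  ... | l , l∈S , z′ = subst (_∈ S) (Null-toℕ-injective l (modP p pr x)
    (Null-trans (+ toℕ l) (+ x) (+ toℕ (modP p pr x)) (Null-sym (+ x) (+ toℕ l) z′) (Null-modP x))) l∈S

  -- Independence of the family

  -- `T` takes the coefficients of the `F i` and of h to the values of the combined function. That
  -- function has degree at most s, so `T` is injective modulo p already on the low points, and
  -- dimensions can be compared.
  family-dim : (L K : Subset p) → (∀ x → x ∈ L → x ∉ K) →
    ∀ N m (A : Fin m → Subset (suc N)) →
    (∀ i → modP p pr ∣ A i ∣ ∈ K) →
    (∀ i j → ¬ i ≡ j → modP p pr ∣ A i ∩ A j ∣ ∈ L) →
    2 * ∣ L ∣ ≤ N + 2 * ∣ K ∣ → ∣ L ∣ < p →
    m + dim N (suc ∣ L ∣ ∸ 2 * ∣ K ∣) ≤ dim N (suc ∣ L ∣)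
  family-dim L K disjoint N m A A∈K A∩A∈L s≤N s<p =
    subst (m + dim N d ≤_) (length-lowPoints N (suc s))
      (injective⇒≤ T T-linear (lowPoints N (suc s)) λ a z →
        T-injective a (Null-lowPoints N (suc s) (Deg-T a) z))
    where
    s = ∣ L ∣
    r = ∣ K ∣
    -- `Deg` bounds strictly, so this means degree at most s - 2r; when 2r > s it is 0 and h drops
    -- out.
    d = suc s ∸ 2 * r

    F : Fin m → Subset N → ℤ
    F i x = prodLin (roots L 0ℤ) (+ ∣ A i ∩ (inside ∷ x) ∣)

    -- Removing one point from A j lowers its size by at most one, hence the roots in K and in K − 1.
    ηs : List ℤ
    ηs = roots K 0ℤ ++ roots K (ℤ.- 1ℤ)

    γ : Subset N → ℤ
    γ x = prodLin ηs (+ ∣ x ∣)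

    length-ηs : length ηs ≡ 2 * r
    length-ηs = trans (List.length-++ (roots K 0ℤ)) (cong₂ _+_ (length-roots K 0ℤ)
      (trans (length-roots K (ℤ.- 1ℤ)) (sym (ℕ.+-identityʳ r))))

    T : Subset N → (Fin (m + dim N d) → ℤ) → ℤ
    T x a = comb (λ i → F i x) (a ∘ (_↑ˡ dim N d)) ℤ.+ γ x ℤ.* poly N d (a ∘ (m ↑ʳ_)) x

    T-linear : ∀ x → Linear (T x)
    T-linear x = Linear-+ (Linear-reindex (_↑ˡ dim N d) (Linear-comb (λ i → F i x)))
      (Linear-* (γ x) (Linear-reindex (m ↑ʳ_) (Linear-poly N d x)))

    Deg-F : ∀ i → Deg N (suc s) (F i)
    Deg-F i = subst (λ e → Deg N (suc e) (F i)) (length-roots L 0ℤ)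
      (Deg-inside N _ {λ x → prodLin (roots L 0ℤ) (+ ∣ A i ∩ x ∣)}
        (Deg-prodLin (suc N) (roots L 0ℤ) {λ x → + ∣ A i ∩ x ∣} (Affine-∩ (A i))))

    Deg-γ* : ∀ b → Deg N (suc s) (λ x → γ x ℤ.* poly N d b x)
    -- The degrees add up to `suc s` only if 2r ≤ s + 1; otherwise truncation makes the polynomial
    -- zero.
    Deg-γ* b with ℕ.≤-total (2 * r) (suc s)
    ... | inj₁ 2r≤ = subst (λ e → Deg N e (λ x → γ x ℤ.* poly N d b x))
      (trans (cong (_+ d) length-ηs) (ℕ.m+[n∸m]≡n 2r≤))
      (Deg-prodLin-* N d ηs (Affine-size N) (Deg-poly N d b))
    ... | inj₂ ≤2r = Deg-cong N (suc s)
      (λ x → sym (trans (cong (γ x ℤ.*_) (poly≡0 x)) (ℤ.*-zeroʳ (γ x)))) (Deg-0 N (suc s))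
      where
      poly≡0 : ∀ x → poly N d b x ≡ 0ℤ
      poly≡0 = subst (λ e → Deg N e (poly N d b)) (ℕ.m≤n⇒m∸n≡0 ≤2r) (Deg-poly N d b)

    Deg-T : ∀ a → Deg N (suc s) (λ x → T x a)
    Deg-T a = Deg-+ N (suc s) (Deg-comb N (suc s) F (a ∘ (_↑ˡ dim N d)) Deg-F) (Deg-γ* (a ∘ (m ↑ʳ_)))

    F-off : ∀ i j → ¬ i ≡ j → head (A j) ≡ inside ⊎ head (A i) ≡ outside → Null (F i (tail (A j)))
    F-off i j i≢j c = subst (λ t → Null (prodLin (roots L 0ℤ) (+ t)))
      (sym (∣∩inside∷tail∣ (A i) (A j) c)) (modP∈⇒Null L ∣ A i ∩ A j ∣ (A∩A∈L i j i≢j))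

    -- The value is taken at the size of `A j` itself, whose residue lies in `K` and so not in `L`.
    F-diag : ∀ j → ¬ Null (F j (tail (A j)))
    F-diag j z = disjoint _ (Null⇒modP∈ L ∣ A j ∣ (subst (λ t → Null (prodLin (roots L 0ℤ) (+ t)))
      (trans (∣∩inside∷tail∣ (A j) (A j) (head-cases (A j))) (cong ∣_∣ (∩-idem (A j)))) z)) (A∈K j)

    γ-root : ∀ (S : Subset (suc N)) → modP p pr ∣ S ∣ ∈ K → Null (γ (tail S))
    γ-root (outside ∷ S) k∈K = Null-prodLin⁺ ηs (+ ∣ S ∣)
      (Any.++⁺ˡ (roots⁺ K 0ℤ (+ ∣ S ∣) k∈K (Null-modP ∣ S ∣)))
    γ-root (inside ∷ S) k∈K = Null-prodLin⁺ ηs (+ ∣ S ∣)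
      (Any.++⁺ʳ (roots K 0ℤ) (roots⁺ K (ℤ.- 1ℤ) (+ ∣ S ∣) k∈K
        (subst Null (lemma (+ ∣ S ∣) (+ toℕ (modP p pr (suc ∣ S ∣)))) (Null-modP (suc ∣ S ∣)))))
      where
      lemma : ∀ v k → (1ℤ ℤ.+ v) ℤ.- k ≡ v ℤ.- ((ℤ.- 1ℤ) ℤ.+ k)
      lemma = solve-∀

    poly-Null : ∀ d → d ≡ suc s ∸ 2 * r → ∀ b → (∀ x → Null (γ x ℤ.* poly N d b x)) → ∀ i → Null (b i)
    poly-Null (suc e) eq b z = poly-independent N (suc e) b
      (cancel-prodLin-cube e N ηs (Deg-poly N (suc e) b) bound
        (subst (_< p) (trans (sym e+2r≡s) (cong (_+_ e) (sym length-ηs))) s<p) z)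
      where
      e+2r≡s : e + 2 * r ≡ s
      e+2r≡s = ℕ.suc-injective (trans (cong (_+ 2 * r) eq)
        (ℕ.m∸n+n≡m (ℕ.<⇒≤ (ℕ.m∸n≢0⇒n<m {suc s} {2 * r} λ eq0 → ℕ.1+n≢0 (trans eq eq0)))))
      regroup : ∀ e t → 2 * (e + t) ≡ (2 * e + t) + t
      regroup = ℕ-Ring.solve-∀
      bound : 2 * e + length ηs ≤ N
      -- Substituting s = e + 2r into 2s ≤ N + 2r leaves 2e + 2r ≤ N, the room that the cancellation
      -- on the cube asks for.
      bound = ℕ.+-cancelʳ-≤ (2 * r) _ _ (subst (_≤ N + 2 * r)
        (trans (cong (2 *_) (sym e+2r≡s)) (trans (regroup e (2 * r)) (cong (λ t → 2 * e + t + 2 * r) (sym length-ηs)))) s≤N)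

    T-injective : ∀ a → (∀ x → Null (T x a)) → ∀ i → Null (a i)
    T-injective a z = splitAt-elim m (λ i → Null (a i)) b-Null
      (poly-Null d refl (a ∘ (m ↑ʳ_)) λ x → ∣m+n∣m⇒∣n (z x)
        (comb-Null (λ i → F i x) b (λ i → ∣n⇒∣m*n (F i x) (b-Null i))))
      where
      b : Fin m → ℤ
      b = a ∘ (_↑ˡ dim N d)
      isolate : ∀ j → (∀ i → ¬ i ≡ j → Null (F i (tail (A j)) ℤ.* b i)) → Null (b j)
      -- At `tail (A j)` the term with `γ` is null, and `F j` is not.
      isolate j zs = Null-cancel (F j (tail (A j))) (b j) (F-diag j)
        (comb-isolate (λ i → F i (tail (A j))) b j
          (∣m+n∣n⇒∣m (z (tail (A j))) (∣m⇒∣m*n _ (γ-root (A j) (A∈K j)))) zs)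
      inside-Null : ∀ j → head (A j) ≡ inside → Null (b j)
      inside-Null j h = isolate j λ i i≢j → ∣m⇒∣m*n (b i) (F-off i j i≢j (inj₁ h))
      b-Null : ∀ j → Null (b j)
      -- If `A i` contains the first point, `b i` is already null; otherwise the substitution leaves
      -- the intersection with `A j` unchanged and `F i` is null.
      b-Null j = isolate j λ i i≢j → case-head i i≢j (head-cases (A i))
        where
        case-head : ∀ i → ¬ i ≡ j → head (A i) ≡ inside ⊎ head (A i) ≡ outside → Null (F i (tail (A j)) ℤ.* b i)
        case-head i i≢j (inj₁ h) = ∣n⇒∣m*n (F i (tail (A j))) (inside-Null i h)
        case-head i i≢j (inj₂ h) = ∣m⇒∣m*n (b i) (F-off i j i≢j (inj₂ h))

-- From dimensions to the binomial bound

∉⇒∣p∣<n : ∀ {n} (S : Subset n) {x} → x ∉ S → ∣ S ∣ < n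
∉⇒∣p∣<n S {x} x∉S = ℕ.≤∧≢⇒< (∣p∣≤n S) λ eq → x∉S (subst (x ∈_) (sym (∣p∣≡n⇒p≡⊤ eq)) ∈⊤)

theorem1p15 : (p : ℕ) (pr : Prime p) (L K : Subset p) →
    (∀ x → x ∈ L → x ∉ K) →
    (n m : ℕ) (A : Fin m → Subset n) → Injective _≡_ _≡_ A →
    (∀ i → modP p pr ∣ A i ∣ ∈ K) →
    (∀ i j → ¬ i ≡ j → modP p pr ∣ A i ∩ A j ∣ ∈ L) →
    2 * ∣ L ∣ + 1 ≤ n + 2 * ∣ K ∣ →
    m ≤ boundSum n ∣ L ∣ ∣ K ∣
theorem1p15 p pr L K disjoint n zero A inj A∈K A∩A∈L n≥ = z≤n
-- Truncation gives `n ∸ 1` the value 0 here. As 2s + 1 ≤ 2r, the dimension to be subtracted is 0,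
-- so the sum equals `dim 0 (suc s)`, which is 1.
theorem1p15 p pr L K disjoint zero (suc zero) A inj A∈K A∩A∈L n≥ =
  ℕ.≤-reflexive (sym (trans (sym (ℕ.+-identityʳ (boundSum 0 ∣ L ∣ ∣ K ∣)))
    (trans (cong (λ t → boundSum 0 ∣ L ∣ ∣ K ∣ + dim 0 t) (sym (ℕ.m≤n⇒m∸n≡0 s<2r))) (boundSum-dim 0 ∣ L ∣ ∣ K ∣))))
  where
  s<2r : suc ∣ L ∣ ≤ 2 * ∣ K ∣
  s<2r = ℕ.≤-trans (subst (suc ∣ L ∣ ≤_) (ℕ.+-comm 1 (2 * ∣ L ∣)) (s≤s (ℕ.m≤m+n ∣ L ∣ _))) n≥
theorem1p15 p pr L K disjoint zero (suc (suc m)) A inj A∈K A∩A∈L n≥ = ⊥-elim (Fin.0≢1+n (inj {zero} {suc zero} (empty (A zero) (A (suc zero)))))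
  where
  empty : (S T : Subset 0) → S ≡ T
  empty [] [] = refl
theorem1p15 p pr L K disjoint (suc N) m@(suc _) A inj A∈K A∩A∈L n≥ =
  ℕ.+-cancelʳ-≤ (dim N (suc ∣ L ∣ ∸ 2 * ∣ K ∣)) m _
    (subst (m + dim N (suc ∣ L ∣ ∸ 2 * ∣ K ∣) ≤_) (sym (boundSum-dim N ∣ L ∣ ∣ K ∣))
      (Modulo.family-dim p pr L K disjoint N m A A∈K A∩A∈L
        (s≤s⁻¹ (subst (_≤ suc N + 2 * ∣ K ∣) (ℕ.+-comm (2 * ∣ L ∣) 1) n≥))
        -- The family is nonempty, so the residue of its first size lies in `K` and outside `L`;
        -- hence s < p.
        (∉⇒∣p∣<n L λ k∈L → disjoint _ k∈L (A∈K zero))))
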